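{- Let $V$ be a set of truth values containing distinct elements $1$ and $0$, equipped with a partial order $\leq$ (reflexive, transitive, antisymmetric) such that $0\leq x\leq 1$ for all $x\in V$. Define the order-theoretic truth-relation $\models_{\leq}\subseteq\mathcal{P}(V)\times\mathcal{P}(V)$ by: $\gamma\models_{\leq}\delta$ iff ($\exists x\in\gamma,\exists y\in\delta: x\leq y$) or $0\in\gamma$ or $1\in\delta$. Then $\models_{\leq}$ equals the intersection of all pure consequence relations $\models_{\mathcal{D},\mathcal{D}}$, where $\mathcal{D}$ ranges over the sets of designated values that are upsets for $\leq$.
   Context: A set of designated values is a subset $\mathcal{D}\subseteq V$ with $1\in\mathcal{D}$ and $0\notin\mathcal{D}$. For sets of designated values $\mathcal{D}_p,\mathcal{D}_c$, the mixed consequence truth-relation $\models_{\mathcal{D}_p,\mathcal{D}_c}$ on $\mathcal{P}(V)\times\mathcal{P}(V)$ is defined by $\gamma\models_{\mathcal{D}_p,\mathcal{D}_c}\delta$ iff ($\gamma\subseteq\mathcal{D}_p$ implies $\delta\cap\mathcal{D}_c\neq\emptyset$); it is pure when $\mathcal{D}_p=\mathcal{D}_c$. A set $U\subseteq V$ is an upset for $\leq$ if $x\in U$ and $x\leq y$ imply $y\in U$. -}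

module Defs where

open import Level using (Level; suc)
open import Data.Product using (∃₂; _×_)
open import Data.Sum using (_⊎_)
open import Relation.Binary.Core using (Rel)
open import Relation.Binary.Definitions using (_Respects_)
open import Relation.Unary using (Pred; _∈_; _∉_; _⊆_; _∩_; Satisfiable)

private
  variable
    ℓ : Level

-- The truth values V, the order and all subsets share one level ℓ, so that
-- the up-closure of a subset is again an element of 𝒫 V.
𝒫 : Set ℓ → Set (suc ℓ)
𝒫 {ℓ} V = Pred V ℓ

TruthRelation : Set ℓ → (ℓ′ : Level) → Set _
TruthRelation V ℓ′ = Rel (𝒫 V) ℓ′

record DesignatedSet {V : Set ℓ} (𝟏 𝟎 : V) : Set (suc ℓ) where
  field
    values : 𝒫 V
    𝟏∈     : 𝟏 ∈ values
    𝟎∉     : 𝟎 ∉ values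

open DesignatedSet public

module _ {V : Set ℓ} {𝟏 𝟎 : V} where

  -- δ ∩ 𝒟c ≠ ∅ is read positively, as inhabitedness.
  mixed : (𝒟p 𝒟c : DesignatedSet 𝟏 𝟎) → TruthRelation V ℓ
  mixed 𝒟p 𝒟c γ δ = γ ⊆ values 𝒟p → Satisfiable (δ ∩ values 𝒟c)

  pure : DesignatedSet 𝟏 𝟎 → TruthRelation V ℓ
  pure 𝒟 = mixed 𝒟 𝒟

IsUpset : {V : Set ℓ} → Rel V ℓ → Pred (𝒫 V) ℓ
IsUpset _≤_ U = U Respects _≤_

orderTheoretic : {V : Set ℓ} → Rel V ℓ → (𝟏 𝟎 : V) → TruthRelation V ℓ
orderTheoretic _≤_ 𝟏 𝟎 γ δ =
  (∃₂ λ x y → x ∈ γ × y ∈ δ × x ≤ y) ⊎ 𝟎 ∈ γ ⊎ 𝟏 ∈ δ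

⋂pureUpset : {V : Set ℓ} → Rel V ℓ → (𝟏 𝟎 : V) → TruthRelation V (suc ℓ)
⋂pureUpset _≤_ 𝟏 𝟎 γ δ =
  (𝒟 : DesignatedSet 𝟏 𝟎) → IsUpset _≤_ (values 𝒟) → pure 𝒟 γ δ

{-# OPTIONS --safe #-}
-- When 𝟎 ∉ γ, the up-closure of γ ∪ {𝟏} is a designated upset containing γ;
-- any element of δ in it lies above an element of γ or equals 𝟏.
module Submission where

open import Defs
open import Axiom.ExcludedMiddle using (ExcludedMiddle)
open import Data.Empty using (⊥-elim)
open import Data.Product using (∃; _×_; _,_)
open import Data.Sum using (inj₁; inj₂; [_,_])
open import Relation.Binary.Core using (Rel; _⇔_)
open import Relation.Binary.Definitions using (Maximum; Minimum)
open import Relation.Binary.Structures using (IsPartialOrder)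
open import Relation.Binary.PropositionalEquality using (_≡_; _≢_; refl; subst)
open import Relation.Nullary using (yes; no)
open import Relation.Unary using (_∈_; _∉_; _∪_; ｛_｝)

-- Soundness is immediate, since membership in an upset travels along `≤`. Conversely, for each `γ`
-- without `𝟎`, one test set decides everything: the least upset containing `γ` and `𝟏`. It is
-- contained in every designated upset that includes `γ`, so it makes the strongest demand on `δ`.

module _ {ℓ} {V : Set ℓ} {_≤_ : Rel V ℓ} (po : IsPartialOrder _≡_ _≤_) where

  private module ≤ = IsPartialOrder po

  upClosure : 𝒫 V → 𝒫 V
  upClosure U y = ∃ λ x → x ∈ U × x ≤ y

  upClosure-isUpset : ∀ U → IsUpset _≤_ (upClosure U)
  upClosure-isUpset U y≤z (x , x∈U , x≤y) = x , x∈U , ≤.trans x≤y y≤z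

  -- By antisymmetry only `𝟎` lies below `𝟎`, so closing upward cannot introduce it.
  minimum∈upClosure⇒∈ : ∀ {𝟎} → Minimum _≤_ 𝟎 → ∀ {U} → 𝟎 ∈ upClosure U → 𝟎 ∈ U
  minimum∈upClosure⇒∈ min {U} (x , x∈U , x≤𝟎) = subst U (≤.antisym x≤𝟎 (min x)) x∈U

  -- Adjoining `𝟏` makes it designated even when `γ` is empty; `𝟏 ≢ 𝟎` keeps this from bringing in
  -- `𝟎`.
  generated : ∀ {𝟏 𝟎} → 𝟏 ≢ 𝟎 → Minimum _≤_ 𝟎 → (γ : 𝒫 V) → 𝟎 ∉ γ → DesignatedSet 𝟏 𝟎
  generated {𝟏} {𝟎} 𝟏≢𝟎 min γ 𝟎∉γ = record
    { values = upClosure (γ ∪ ｛ 𝟏 ｝)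
    ; 𝟏∈     = 𝟏 , inj₂ refl , ≤.refl
    ; 𝟎∉     = λ 𝟎∈↑ → [ 𝟎∉γ , 𝟏≢𝟎 ] (minimum∈upClosure⇒∈ min {γ ∪ ｛ 𝟏 ｝} 𝟎∈↑)
    }

theorem2p14 : ∀ {ℓ} → ExcludedMiddle ℓ →
    (V : Set ℓ) (𝟏 𝟎 : V) → 𝟏 ≢ 𝟎 →
    (_≤_ : Rel V ℓ) → IsPartialOrder _≡_ _≤_ →
    Minimum _≤_ 𝟎 → Maximum _≤_ 𝟏 →
    orderTheoretic _≤_ 𝟏 𝟎 ⇔ ⋂pureUpset _≤_ 𝟏 𝟎
theorem2p14 em V 𝟏 𝟎 𝟏≢𝟎 _≤_ po min max = sound , complete
  where
  open IsPartialOrder po using (antisym) renaming (refl to ≤-refl)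

  sound : ∀ {γ δ} → orderTheoretic _≤_ 𝟏 𝟎 γ δ → ⋂pureUpset _≤_ 𝟏 𝟎 γ δ
  sound (inj₁ (x , y , x∈γ , y∈δ , x≤y)) 𝒟 up γ⊆𝒟 = y , y∈δ , up x≤y (γ⊆𝒟 x∈γ)
  sound (inj₂ (inj₁ 𝟎∈γ))                𝒟 up γ⊆𝒟 = ⊥-elim (𝟎∉ 𝒟 (γ⊆𝒟 𝟎∈γ))
  sound (inj₂ (inj₂ 𝟏∈δ))                𝒟 up γ⊆𝒟 = 𝟏 , 𝟏∈δ , 𝟏∈ 𝒟

  complete : ∀ {γ δ} → ⋂pureUpset _≤_ 𝟏 𝟎 γ δ → orderTheoretic _≤_ 𝟏 𝟎 γ δ
  -- The case split is classical: the test set is designated only once `𝟎 ∉ γ` is known.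
  complete {γ} {δ} γ⊨δ with em {𝟎 ∈ γ}
  ... | yes 𝟎∈γ = inj₂ (inj₁ 𝟎∈γ)
  ... | no  𝟎∉γ
    with γ⊨δ (generated po 𝟏≢𝟎 min γ 𝟎∉γ) (upClosure-isUpset po (γ ∪ ｛ 𝟏 ｝))
             (λ {x} x∈γ → x , inj₁ x∈γ , ≤-refl)
  ... | y , y∈δ , x , inj₁ x∈γ , x≤y = inj₁ (x , y , x∈γ , y∈δ , x≤y)
  -- Here `y` lies above the adjoined `𝟏`, the greatest element, so the two coincide.
  ... | y , y∈δ , _ , inj₂ refl , 𝟏≤y = inj₂ (inj₂ (subst δ (antisym (max y) 𝟏≤y) y∈δ))
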